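{- Let $\mathbb K=(K,\oplus,\otimes,\mathbf 0,\mathbf 1)$ be a commutative complete semiring (or $\omega$-complete with $K$ countable), with $\mathbf 0\neq\mathbf 1$. For every $\mathbb K$-annotated $\mathcal{ELHI}^n_\bot$ ontology $\mathcal O^{\mathbb K}=\langle\mathcal O,\lambda\rangle$ and every $\alpha$ that is an assertion, a BCQ, an RI, or a GCI between basic concepts: - $\mathcal O\not\models\alpha$ implies $\mathcal P(\alpha,\mathcal O^{\mathbb K})=\mathbf 0$; - if $\mathbb K$ is positive, $\alpha$ is an assertion, a BCQ, or an RI, and $\mathcal P(\alpha,\mathcal O^{\mathbb K})=\mathbf 0$, then $\mathcal O\not\models\alpha$; - if $\mathbb K$ is positive and $\otimes$-idempotent, $\mathcal O$ does not contain any GCI with $\top$ as left-hand side, and $\mathcal P(\alpha,\mathcal O^{\mathbb K})=\mathbf 0$, then $\mathcal O\not\models\alpha$.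
   Context: Syntax. Let $\mathsf{N_C},\mathsf{N_R},\mathsf{N_I}$ be mutually disjoint countable sets of concept, role and individual names. A role $P$ is a role name $R\in\mathsf{N_R}$ or an inverse role $R^-$. Concepts: $C::=A\mid\exists P.C\mid C\sqcap C\mid\top$ ($A\in\mathsf{N_C}$); $\exists P$ abbreviates $\exists P.\top$; basic concepts are those of the form $A$ or $\exists P$. $\mathcal{ELHI}^n_\bot$ axioms: assertions $A(a)$, $R(a,b)$; GCIs $C\sqsubseteq D$ with $C::=A\mid\exists P.C\mid C\sqcap C\mid\top$ and $D::=A\mid\exists P.\top\mid\bot$; role inclusions (RIs) $P\sqsubseteq Q$ (positive) and $P\sqcap Q\sqsubseteq\bot$ (negative). An ontology is a finite set of axioms. A BCQ is $\exists\vec y\,\phi(\vec y)$ with $\phi$ a conjunction of atoms $A(t)$, $R(t,t')$, terms in $\mathsf{N_I}\cup\vec y$. Classical interpretations, models, satisfaction and entailment $\mathcal O\models\alpha$ are the usual (first-order) ones for description logics. Semirings. $\mathbb K$ is positive if for all $a,b\in K$: $a\otimes b=\mathbf 0$ iff $a=\mathbf 0$ or $b=\mathbf 0$, and $a\oplus b=\mathbf 0$ iff $a=b=\mathbf 0$. It is $\otimes$-idempotent if $a\otimes a=a$ for all $a$. It is complete (resp. $\omega$-complete) if sums $\bigoplus_{i\in I}a_i$ are defined for all (resp. all at most countable) families, agree with $\mathbf 0$ and the finite sums for empty and finite $I$, satisfy $\bigoplus_{i\in I}a_i=\bigoplus_{j\in J}\bigoplus_{i\in I_j}a_i$ for every partition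 $(I_j)_{j\in J}$ of $I$, and $\otimes$ distributes over them. Annotated semantics. A $\mathbb K$-annotated ontology is a pair $\langle\mathcal O,\lambda\rangle$ with $\lambda:\mathcal O\to K\setminus\{\mathbf 0\}$, identified with the set of annotated axioms $(\alpha,\lambda(\alpha))$. A $\mathbb K$-annotated interpretation $\mathcal I$ has a nonempty domain $\Delta^{\mathcal I}$ and maps $a\in\mathsf{N_I}$ to $a^{\mathcal I}\in\Delta^{\mathcal I}$, $A\in\mathsf{N_C}$ to $A^{\mathcal I}\subseteq\Delta^{\mathcal I}\times K$, $R\in\mathsf{N_R}$ to $R^{\mathcal I}\subseteq\Delta^{\mathcal I}\times\Delta^{\mathcal I}\times K$, with $\top^{\mathcal I}=\Delta^{\mathcal I}\times\{\mathbf 1\}$, $\bot^{\mathcal I}=\emptyset$, $(R^-)^{\mathcal I}=\{(e,d,\kappa)\mid(d,e,\kappa)\in R^{\mathcal I}\}$, $(\exists P.C)^{\mathcal I}=\{(d,\kappa\otimes\kappa')\mid\exists e:(d,e,\kappa)\in P^{\mathcal I},(e,\kappa')\in C^{\mathcal I}\}$, $(C\sqcap D)^{\mathcal I}=\{(d,\kappa\otimes\kappa')\mid(d,\kappa)\in C^{\mathcal I},(d,\kappa')\in D^{\mathcal I}\}$, $(P\sqcap Q)^{\mathcal I}=\{(d,e,\kappa\otimes\kappa')\mid(d,e,\kappa)\in P^{\mathcal I},(d,e,\kappa')\in Q^{\mathcal I}\}$. $\mathcal I$ satisfies $(C\sqsubseteq D,\kappa)$ if $(d,\kappa')\in C^{\mathcal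 I}$ implies $(d,\kappa\otimes\kappa')\in D^{\mathcal I}$; $(P\sqsubseteq Q,\kappa)$ if $(d,e,\kappa')\in P^{\mathcal I}$ implies $(d,e,\kappa\otimes\kappa')\in Q^{\mathcal I}$; $(P\sqcap Q\sqsubseteq\bot,\kappa)$ if $(P\sqcap Q)^{\mathcal I}=\emptyset$; $(A(a),\kappa)$ if $(a^{\mathcal I},\kappa)\in A^{\mathcal I}$; $(R(a,b),\kappa)$ if $(a^{\mathcal I},b^{\mathcal I},\kappa)\in R^{\mathcal I}$. $\mathcal I\models(q,\kappa)$ for a BCQ $q$ if there are a map $\pi$ from the terms of $q$ to $\Delta^{\mathcal I}$ with $\pi(c)=c^{\mathcal I}$ for $c\in\mathsf{N_I}$ and, for each atom occurrence $E(\vec t)$ of $q$, some $\kappa_{E(\vec t)}\in K$ with $(\pi(\vec t),\kappa_{E(\vec t)})\in E^{\mathcal I}$, such that $\kappa$ is the $\otimes$-product of all these elements. Models satisfy all annotated axioms; $\mathcal O^{\mathbb K}\models(\alpha,\kappa)$ if every model satisfies $(\alpha,\kappa)$. Provenance. $\mathcal P(\alpha,\mathcal O^{\mathbb K})=\bigoplus_{\kappa:\ \mathcal O^{\mathbb K}\models(\alpha,\kappa)}\kappa$ (sum over a set; the empty sum is $\mathbf 0$).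
   Formalization: In the third item, the ontology must contain no GCI whose left-hand side is ⊤ or a conjunction of ⊤'s only (such as ⊤⊓⊤); read literally, {⊤⊓⊤ ⊑ A} with α = B ⊑ A over the Boolean semiring is a counterexample. -}

module Defs where

open import Level using (Level; Setω; _⊔_; suc)
open import Algebra.Bundles using (CommutativeSemiring)
import Algebra.Definitions
import Algebra.Definitions.RawMonoid
open import Data.Nat using (ℕ)
open import Data.Fin using (Fin)
open import Data.List using (List; length; lookup)
open import Data.List.Membership.Propositional using (_∈_)
open import Data.Product using (Σ; ∃; ∃-syntax; _×_; _,_; proj₁; proj₂)
open import Data.Sum using (_⊎_)
open import Data.Unit.Polymorphic using (⊤; tt)
open import Data.Empty.Polymorphic using (⊥)
open import Function.Base using (_∘_)
open import Function.Bundles using (Func; Inverse; Injection; _⇔_)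
open import Relation.Binary.Bundles using (Setoid)
import Relation.Binary.Construct.On as On
open import Relation.Binary.PropositionalEquality using (setoid)
open import Relation.Nullary using (¬_)

private
  variable
    i e j f p : Level

-- At most countable: finite sets are included.
Countable : Setoid i e → Set (i ⊔ e)
Countable I = Injection I (setoid ℕ)

------------------------------------------------------------------------
-- Syntax

record Signature : Set₁ where
  field
    NC NR NI     : Set
    NC-countable : Countable (setoid NC)
    NR-countable : Countable (setoid NR)
    NI-countable : Countable (setoid NI)

module _ (S : Signature) where
  open Signature S

  data Role : Set where
    name : NR → Role
    _⁻   : NR → Role

  data Concept : Set where
    atom   : NC → Concept
    ∃[_]∙_ : Role → Concept → Concept
    _⊓_    : Concept → Concept → Concept
    top    : Concept

  data Basic : Set where
    atom : NC → Basic
    some : Role → Basic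

  data GCIRight : Set where
    basic : Basic → GCIRight
    bot   : GCIRight

  data Assertion : Set where
    concept : NC → NI → Assertion
    role    : NR → NI → NI → Assertion

  data RoleInclusion : Set where
    _⊑ʳ_   : Role → Role → RoleInclusion
    _⊓_⊑⊥ : Role → Role → RoleInclusion

  data Axiom : Set where
    assertion : Assertion → Axiom
    _⊑_       : Concept → GCIRight → Axiom
    ri        : RoleInclusion → Axiom

  Ontology : Set
  Ontology = List Axiom

  data Term (n : ℕ) : Set where
    ind : NI → Term n
    var : Fin n → Term n

  data Atom (n : ℕ) : Set where
    concept : NC → Term n → Atom n
    role    : NR → Term n → Term n → Atom n

  record BCQ : Set where
    field
      vars : ℕ
      body : List (Atom vars)

  data Query : Set where
    assertion : Assertion → Query
    bcq       : BCQ → Query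
    ri        : RoleInclusion → Query
    _⊑ᵇ_      : Basic → Basic → Query

module _ {S : Signature} where

  ⌜_⌝ : Basic S → Concept S
  ⌜ atom A ⌝ = atom A
  ⌜ some P ⌝ = ∃[ P ]∙ top

  data IsAssertionOrBCQOrRI : Query S → Set where
    assertion : ∀ {α} → IsAssertionOrBCQOrRI (assertion α)
    bcq       : ∀ {q} → IsAssertionOrBCQOrRI (bcq q)
    ri        : ∀ {ρ} → IsAssertionOrBCQOrRI (ri ρ)

  -- Concepts are read up to the trivial identity ⊤ ⊓ ⊤ = ⊤: a conjunction
  -- all of whose conjuncts are ⊤ counts as ⊤ (both have the same
  -- interpretation, also under annotations).
  data IsTop : Concept S → Set where
    top : IsTop top
    _⊓_ : ∀ {C D} → IsTop C → IsTop D → IsTop (C ⊓ D)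

  NoTopGCI : Ontology S → Set
  NoTopGCI O = ∀ {C D} → (C ⊑ D) ∈ O → ¬ IsTop C

------------------------------------------------------------------------
-- Classical semantics, over domains in Set d

record Interpretation (S : Signature) (d : Level) : Set (suc d) where
  open Signature S
  field
    Δ        : Set d
    nonempty : Δ
    indⁱ     : NI → Δ
    conⁱ     : NC → Δ → Set d
    rolⁱ     : NR → Δ → Δ → Set d

module Classical {S : Signature} {d : Level} (I : Interpretation S d) where
  open Interpretation I

  roleⁱ : Role S → Δ → Δ → Set d
  roleⁱ (name R) x y = rolⁱ R x y
  roleⁱ (R ⁻)    x y = rolⁱ R y x

  conceptⁱ : Concept S → Δ → Set d
  conceptⁱ (atom A)     x = conⁱ A x
  conceptⁱ (∃[ P ]∙ C) x = ∃[ y ] roleⁱ P x y × conceptⁱ C y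
  conceptⁱ (C ⊓ D)      x = conceptⁱ C x × conceptⁱ D x
  conceptⁱ top          x = ⊤

  rightⁱ : GCIRight S → Δ → Set d
  rightⁱ (basic B) x = conceptⁱ ⌜ B ⌝ x
  rightⁱ bot       x = ⊥

  satAssertion : Assertion S → Set d
  satAssertion (concept A a) = conⁱ A (indⁱ a)
  satAssertion (role R a b)  = rolⁱ R (indⁱ a) (indⁱ b)

  satRI : RoleInclusion S → Set d
  satRI (P ⊑ʳ Q)   = ∀ x y → roleⁱ P x y → roleⁱ Q x y
  satRI (P ⊓ Q ⊑⊥) = ∀ x y → ¬ (roleⁱ P x y × roleⁱ Q x y)

  satAxiom : Axiom S → Set d
  satAxiom (assertion α) = satAssertion α
  satAxiom (C ⊑ D)       = ∀ x → conceptⁱ C x → rightⁱ D x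
  satAxiom (ri ρ)        = satRI ρ

  termⁱ : ∀ {n} → (Fin n → Δ) → Term S n → Δ
  termⁱ π (ind a) = indⁱ a
  termⁱ π (var v) = π v

  satAtom : ∀ {n} → (Fin n → Δ) → Atom S n → Set d
  satAtom π (concept A t) = conⁱ A (termⁱ π t)
  satAtom π (role R t u)  = rolⁱ R (termⁱ π t) (termⁱ π u)

  satBCQ : BCQ S → Set d
  satBCQ q = ∃[ π ] (∀ o → satAtom {BCQ.vars q} π (lookup (BCQ.body q) o))

  satQuery : Query S → Set d
  satQuery (assertion α) = satAssertion α
  satQuery (bcq q)       = satBCQ q
  satQuery (ri ρ)        = satRI ρ
  satQuery (B ⊑ᵇ B′)     = ∀ x → conceptⁱ ⌜ B ⌝ x → conceptⁱ ⌜ B′ ⌝ x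

  IsModel : Ontology S → Set d
  IsModel O = ∀ {α} → α ∈ O → satAxiom α

Entails : {S : Signature} (d : Level) → Ontology S → Query S → Set (suc d)
Entails {S} d O α =
  (I : Interpretation S d) → Classical.IsModel I O → Classical.satQuery I α

------------------------------------------------------------------------
-- Semirings with infinite sums

-- Sets are represented by setoids, a subset of a setoid by a predicate
-- with the inherited equality; so the elements of a subset are not
-- distinguished by their membership proofs.
subset : (I : Setoid i e) → (Setoid.Carrier I → Set p) → Setoid (i ⊔ p) e
subset I P = On.setoid {B = Σ (Setoid.Carrier I) P} I proj₁

restrict : ∀ {I : Setoid i e} {X : Setoid j f} (P : Setoid.Carrier I → Set p) →
           Func I X → Func (subset I P) X
restrict P a = record { to = Func.to a ∘ proj₁ ; cong = Func.cong a }

-- A partition (block j)_{j ∈ J} of I.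
record Partition (I : Setoid i e) (J : Setoid j f) (p : Level)
       : Set (i ⊔ e ⊔ j ⊔ f ⊔ suc p) where
  private
    module I = Setoid I
    module J = Setoid J
  field
    block    : J.Carrier → I.Carrier → Set p
    respects : ∀ {x x′ y y′} → x I.≈ x′ → y J.≈ y′ → block y x → block y′ x′
    cover    : ∀ x → ∃[ y ] block y x
    disjoint : ∀ {x y y′} → block y x → block y′ x → y J.≈ y′

module _ {c ℓ : Level} (𝕂 : CommutativeSemiring c ℓ) where
  open CommutativeSemiring 𝕂 renaming (setoid to K)

  Family : Setoid i e → Set (c ⊔ ℓ ⊔ i ⊔ e)
  Family I = Func I K

  scale : {I : Setoid i e} → Carrier → Family I → Family I
  scale x a = record
    { to = λ s → x * Func.to a s ; cong = λ eq → *-congˡ (Func.cong a eq) }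

  finiteSum : ∀ {n} → (Fin n → Carrier) → Carrier
  finiteSum = Algebra.Definitions.RawMonoid.sum +-rawMonoid

  finiteProduct : ∀ {n} → (Fin n → Carrier) → Carrier
  finiteProduct = Algebra.Definitions.RawMonoid.sum *-rawMonoid

  -- Sums of all families whose index set satisfies Adm.  The empty sum is
  -- the case n = 0 of ⨁-finite.  By ⨁-cong a sum depends neither on the
  -- admissibility proof nor on the choice among pointwise equal families.
  record InfiniteSums (Adm : ∀ {i e} → Setoid i e → Set (i ⊔ e)) : Setω where
    field
      ⨁           : (I : Setoid i e) → Adm I → Family I → Carrier
      ⨁-cong      : (I : Setoid i e) (s t : Adm I) (a b : Family I) →
                    (∀ x → Func.to a x ≈ Func.to b x) → ⨁ I s a ≈ ⨁ I t b
      ⨁-finite    : ∀ {n} (I : Setoid i e) (s : Adm I) (a : Family I) →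
                    (φ : Inverse (setoid (Fin n)) I) →
                    ⨁ I s a ≈ finiteSum (λ k → Func.to a (Inverse.to φ k))
      ⨁-partition : (I : Setoid i e) (J : Setoid j f) (π : Partition I J p) →
                    let open Partition π in
                    (s : Adm I) (t : Adm J)
                    (r : ∀ y → Adm (subset I (block y)))
                    (a : Family I) (b : Family J) →
                    (∀ y → Func.to b y ≈
                           ⨁ (subset I (block y)) (r y) (restrict (block y) a)) →
                    ⨁ I s a ≈ ⨁ J t b
      ⨁-distrib   : (I : Setoid i e) (s : Adm I) (x : Carrier) (a : Family I) →
                    x * ⨁ I s a ≈ ⨁ I s (scale x a)

  Complete : Setω
  Complete = InfiniteSums (λ _ → ⊤)

  ω-Complete : Setω
  ω-Complete = InfiniteSums Countable

  data Summability : Setω where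
    complete   : Complete → Summability
    ω-complete : ω-Complete → Countable K → Summability

  sumOver : Summability → (Carrier → Set p) → Carrier
  sumOver (complete sums) P =
    InfiniteSums.⨁ sums (subset K P) tt (record { to = proj₁ ; cong = λ eq → eq })
  sumOver (ω-complete sums count) P =
    InfiniteSums.⨁ sums (subset K P) countable
      (record { to = proj₁ ; cong = λ eq → eq })
    where
    countable : Countable (subset K P)
    countable = record
      { to        = Injection.to count ∘ proj₁
      ; cong      = Injection.cong count
      ; injective = Injection.injective count
      }

  record IsPositive : Set (c ⊔ ℓ) where
    field
      *-zero⇔ : ∀ a b → (a * b ≈ 0#) ⇔ (a ≈ 0# ⊎ b ≈ 0#)
      +-zero⇔ : ∀ a b → (a + b ≈ 0#) ⇔ (a ≈ 0# × b ≈ 0#)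

  ⊗-Idempotent : Set (c ⊔ ℓ)
  ⊗-Idempotent = Algebra.Definitions.Idempotent _≈_ _*_

------------------------------------------------------------------------
-- Annotated semantics

  -- Only the values of annot on members of ontology matter.
  record AnnotatedOntology (S : Signature) : Set (c ⊔ ℓ) where
    field
      ontology : Ontology S
      annot    : Axiom S → Carrier
      nonzero  : ∀ {α} → α ∈ ontology → ¬ (annot α ≈ 0#)

  record AnnInterpretation (S : Signature) : Set (suc (c ⊔ ℓ)) where
    open Signature S
    field
      Δ        : Set (c ⊔ ℓ)
      nonempty : Δ
      indⁱ     : NI → Δ
      conⁱ     : NC → Δ → Carrier → Set (c ⊔ ℓ)
      rolⁱ     : NR → Δ → Δ → Carrier → Set (c ⊔ ℓ)
      con-resp : ∀ {A x κ κ′} → κ ≈ κ′ → conⁱ A x κ → conⁱ A x κ′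
      rol-resp : ∀ {R x y κ κ′} → κ ≈ κ′ → rolⁱ R x y κ → rolⁱ R x y κ′

  module Annotated {S : Signature} (I : AnnInterpretation S) where
    open AnnInterpretation I

    roleⁱ : Role S → Δ → Δ → Carrier → Set (c ⊔ ℓ)
    roleⁱ (name R) x y κ = rolⁱ R x y κ
    roleⁱ (R ⁻)    x y κ = rolⁱ R y x κ

    role⊓ⁱ : Role S → Role S → Δ → Δ → Carrier → Set (c ⊔ ℓ)
    role⊓ⁱ P Q x y κ =
      ∃[ κ₁ ] ∃[ κ₂ ] roleⁱ P x y κ₁ × roleⁱ Q x y κ₂ × κ ≈ κ₁ * κ₂

    conceptⁱ : Concept S → Δ → Carrier → Set (c ⊔ ℓ)
    conceptⁱ (atom A) x κ = conⁱ A x κ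
    conceptⁱ (∃[ P ]∙ C) x κ =
      ∃[ κ₁ ] ∃[ κ₂ ] (∃[ y ] roleⁱ P x y κ₁ × conceptⁱ C y κ₂) × κ ≈ κ₁ * κ₂
    conceptⁱ (C ⊓ D) x κ =
      ∃[ κ₁ ] ∃[ κ₂ ] conceptⁱ C x κ₁ × conceptⁱ D x κ₂ × κ ≈ κ₁ * κ₂
    conceptⁱ top x κ = Level.Lift (c ⊔ ℓ) (κ ≈ 1#)

    rightⁱ : GCIRight S → Δ → Carrier → Set (c ⊔ ℓ)
    rightⁱ (basic B) x κ = conceptⁱ ⌜ B ⌝ x κ
    rightⁱ bot       x κ = ⊥

    satAssertion : Assertion S → Carrier → Set (c ⊔ ℓ)
    satAssertion (concept A a) κ = conⁱ A (indⁱ a) κ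
    satAssertion (role R a b)  κ = rolⁱ R (indⁱ a) (indⁱ b) κ

    satRI : RoleInclusion S → Carrier → Set (c ⊔ ℓ)
    satRI (P ⊑ʳ Q)   κ = ∀ x y κ′ → roleⁱ P x y κ′ → roleⁱ Q x y (κ * κ′)
    satRI (P ⊓ Q ⊑⊥) κ = ∀ x y κ′ → ¬ role⊓ⁱ P Q x y κ′

    satAxiom : Axiom S → Carrier → Set (c ⊔ ℓ)
    satAxiom (assertion α) κ = satAssertion α κ
    satAxiom (C ⊑ D)       κ = ∀ x κ′ → conceptⁱ C x κ′ → rightⁱ D x (κ * κ′)
    satAxiom (ri ρ)        κ = satRI ρ κ

    termⁱ : ∀ {n} → (Fin n → Δ) → Term S n → Δ
    termⁱ π (ind a) = indⁱ a
    termⁱ π (var v) = π v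

    satAtom : ∀ {n} → (Fin n → Δ) → Atom S n → Carrier → Set (c ⊔ ℓ)
    satAtom π (concept A t) κ = conⁱ A (termⁱ π t) κ
    satAtom π (role R t u)  κ = rolⁱ R (termⁱ π t) (termⁱ π u) κ

    satBCQ : BCQ S → Carrier → Set (c ⊔ ℓ)
    satBCQ q κ =
      Σ (Fin (BCQ.vars q) → Δ) λ π →
      Σ (Fin (length (BCQ.body q)) → Carrier) λ κs →
        (∀ o → satAtom π (lookup (BCQ.body q) o) (κs o)) × κ ≈ finiteProduct κs

    satQuery : Query S → Carrier → Set (c ⊔ ℓ)
    satQuery (assertion α) κ = satAssertion α κ
    satQuery (bcq q)       κ = satBCQ q κ
    satQuery (ri ρ)        κ = satRI ρ κ
    satQuery (B ⊑ᵇ B′)     κ =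
      ∀ x κ′ → conceptⁱ ⌜ B ⌝ x κ′ → conceptⁱ ⌜ B′ ⌝ x (κ * κ′)

    IsModel : AnnotatedOntology S → Set (c ⊔ ℓ)
    IsModel O = ∀ {α} → α ∈ ontology → satAxiom α (annot α)
      where open AnnotatedOntology O

  AnnEntails : {S : Signature} → AnnotatedOntology S → Query S → Carrier →
               Set (suc (c ⊔ ℓ))
  AnnEntails {S} O α κ =
    (I : AnnInterpretation S) → Annotated.IsModel I O → Annotated.satQuery I α κ

  Provenance : {S : Signature} → Summability → Query S → AnnotatedOntology S →
               Carrier
  Provenance sums α O = sumOver sums (AnnEntails O α)

{-# OPTIONS --safe #-}

-- An annotated model becomes a classical one by forgetting annotations, and a
-- classical model becomes an annotated one by attaching every annotation to
-- every fact; the latter gives the first claim.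
--
-- For the other two, a classically entailed query must be annotated with the
-- same nonzero element in all models. That element is read off an annotated
-- Skolem chase, seeded with a generic instance of the left-hand side of the
-- query when there is one. A chase fact carries a scalar k and the number n of
-- uses of the seed in its derivation; mapping the chase into a model in which
-- the seed has annotation z turns (k , n) into k zⁿ. A role inclusion is
-- derived with n = 1. For a basic GCI, the absence of GCIs with left-hand side
-- ⊤ forces n ≥ 1, and then zⁿ = z by idempotency. The facts of the chase with a
-- nonzero scalar form a classical model, by positivity. Finally, a sum with a
-- nonzero summand is nonzero, again by positivity.
module Submission where

open import Defs
open import Level using (Level; _⊔_; lift; lower)
open import Algebra.Bundles using (CommutativeSemiring)
import Algebra.Properties.CommutativeSemigroup as CommutativeSemigroupProperties
import Algebra.Properties.Monoid.Mult as Mult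
import Algebra.Properties.Semiring.Exp as Exp
open import Axiom.ExcludedMiddle using (ExcludedMiddle)
import Data.Empty as Empty
open import Data.Fin using (Fin; zero; suc; toℕ)
open import Data.Fin.Properties using (toℕ-injective)
open import Data.List using (length; lookup)
open import Data.List.Membership.Propositional using (_∈_)
open import Data.Maybe using (Maybe; just; nothing)
open import Data.Nat as ℕ using (ℕ; _≤_; z≤n; s≤s)
open import Data.Nat.Properties using (≤-trans; m≤m+n; m≤n+m)
open import Data.Product using (∃-syntax; _×_; _,_; proj₁; proj₂)
open import Data.Sum using (_⊎_; inj₁; inj₂; [_,_]′)
import Data.Unit as Unit
open import Data.Unit.Polymorphic using (⊤; tt)
open import Function.Base using (id; _∘_)
open import Function.Bundles using (Func; Inverse; Injection; Equivalence)
open import Relation.Binary.Bundles using (Setoid)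
open import Relation.Binary.PropositionalEquality as ≡ using (_≡_)
import Relation.Binary.Reasoning.Setoid as SetoidReasoning
open import Relation.Nullary using (¬_; yes; no; contradiction)

private
  variable
    c ℓ p : Level

-- Infinite sums

module _ {𝕂 : CommutativeSemiring c ℓ}
         {Adm : ∀ {i e} → Setoid i e → Set (i ⊔ e)}
         (sums : InfiniteSums 𝕂 Adm) where
  open CommutativeSemiring 𝕂 hiding (zero) renaming (setoid to K)
  open InfiniteSums sums

  ⨁-empty : ∀ {i e} (I : Setoid i e) (s : Adm I) (a : Family 𝕂 I) →
            ¬ Setoid.Carrier I → ⨁ I s a ≈ 0#
  ⨁-empty I s a empty = ⨁-finite {n = 0} I s a record
    { to        = λ ()
    ; from      = λ x → contradiction x empty
    ; to-cong   = λ { {()} }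
    ; from-cong = λ {x} _ → contradiction x empty
    ; inverse   = (λ {x} _ → contradiction x empty) , (λ { {()} })
    }

  -- Excluded middle splits the index set into the class of `x` and its complement. The total is
  -- then the sum of two block sums, so positivity of addition makes the first one zero, and that
  -- block has a single element up to `≈`. The last two admissibility hypotheses cover the
  -- two-element index set and the blocks.
  ⨁-zero : IsPositive 𝕂 →
           ∀ {i e} → ExcludedMiddle e →
           (I : Setoid i e) (s : Adm I) (a : Family 𝕂 I) →
           Adm (≡.setoid (Fin 2)) →
           (∀ {q} (P : Setoid.Carrier I → Set q) → Adm (subset I P)) →
           ⨁ I s a ≈ 0# → ∀ x → Func.to a x ≈ 0#
  ⨁-zero pos {i} {e} em I s a fin₂ sub ⨁≈0 x = begin
    Func.to a x                 ≈⟨ +-identityʳ _ ⟨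
    Func.to a x + 0#            ≈⟨ ⨁-finite _ _ _ singleton ⟨
    block-sum zero              ≈⟨ proj₁ (Equivalence.to (+-zero⇔ _ _) total) ⟩
    0#                          ∎
    where
    open IsPositive pos
    open SetoidReasoning K
    module I = Setoid I

    block : Fin 2 → I.Carrier → Set e
    block zero    y = y I.≈ x
    block (suc _) y = ¬ y I.≈ x

    block-sum : Fin 2 → Carrier
    block-sum k = ⨁ (subset I (block k)) (sub (block k)) (restrict (block k) a)

    block-sums : Family 𝕂 (≡.setoid (Fin 2))
    block-sums = record { to = block-sum ; cong = reflexive ∘ ≡.cong block-sum }

    partition : Partition I (≡.setoid (Fin 2)) e
    partition = record
      { block    = block
      ; respects = respects
      ; cover    = cover
      ; disjoint = disjoint
      }
      where
      respects : ∀ {y y′ k k′} → y I.≈ y′ → k ≡ k′ → block k y → block k′ y′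
      respects {k = zero}  y≈y′ ≡.refl y≈x = I.trans (I.sym y≈y′) y≈x
      respects {k = suc _} y≈y′ ≡.refl y≉x = y≉x ∘ I.trans y≈y′

      cover : ∀ y → ∃[ k ] block k y
      cover y with em {y I.≈ x}
      ... | yes y≈x = zero , y≈x
      ... | no  y≉x = suc zero , y≉x

      disjoint : ∀ {y k k′} → block k y → block k′ y → k ≡ k′
      disjoint {k = zero}     {zero}     _   _   = ≡.refl
      disjoint {k = zero}     {suc _}    y≈x y≉x = contradiction y≈x y≉x
      disjoint {k = suc _}    {zero}     y≉x y≈x = contradiction y≈x y≉x
      disjoint {k = suc zero} {suc zero} _   _   = ≡.refl

    singleton : Inverse (≡.setoid (Fin 1)) (subset I (block zero))
    singleton = record
      { to        = λ _ → x , I.refl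
      ; from      = λ _ → zero
      ; to-cong   = λ _ → I.refl
      ; from-cong = λ _ → ≡.refl
      ; inverse   = (λ {y} _ → I.sym (proj₂ y)) , λ { {zero} _ → ≡.refl }
      }

    identity : Inverse (≡.setoid (Fin 2)) (≡.setoid (Fin 2))
    identity = record
      { to        = id
      ; from      = id
      ; to-cong   = id
      ; from-cong = id
      ; inverse   = id , id
      }

    total : block-sum zero + (block-sum (suc zero) + 0#) ≈ 0#
    total = begin
      block-sum zero + (block-sum (suc zero) + 0#)
        ≈⟨ ⨁-finite _ fin₂ block-sums identity ⟨
      ⨁ (≡.setoid (Fin 2)) fin₂ block-sums
        ≈⟨ ⨁-partition I _ partition s fin₂ (λ k → sub (block k)) a _ (λ _ → refl) ⟨
      ⨁ I s a
        ≈⟨ ⨁≈0 ⟩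
      0# ∎

module _ {𝕂 : CommutativeSemiring c ℓ} where
  open CommutativeSemiring 𝕂

  sumOver-empty : (sums : Summability 𝕂) (P : Carrier → Set p) →
                  (∀ κ → ¬ P κ) → sumOver 𝕂 sums P ≈ 0#
  sumOver-empty (complete sums)     P empty =
    ⨁-empty sums _ _ _ λ (κ , Pκ) → empty κ Pκ
  sumOver-empty (ω-complete sums _) P empty =
    ⨁-empty sums _ _ _ λ (κ , Pκ) → empty κ Pκ

  sumOver-zero : ExcludedMiddle ℓ → IsPositive 𝕂 →
                 (sums : Summability 𝕂) (P : Carrier → Set p) →
                 sumOver 𝕂 sums P ≈ 0# → ∀ κ → P κ → κ ≈ 0#
  sumOver-zero em pos (complete sums) P sum≈0 κ Pκ =
    ⨁-zero sums pos em _ _ _ tt (λ _ → tt) sum≈0 (κ , Pκ)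
  sumOver-zero em pos (ω-complete sums count) P sum≈0 κ Pκ =
    ⨁-zero sums pos em _ _ _
      (record { to = toℕ ; cong = ≡.cong toℕ ; injective = toℕ-injective })
      (λ _ → record
        { to        = Injection.to count ∘ proj₁ ∘ proj₁
        ; cong      = Injection.cong count
        ; injective = Injection.injective count
        })
      sum≈0 (κ , Pκ)

-- Inverse roles and concepts built from ⊤ alone.

module _ {S : Signature} where

  inverse : Role S → Role S
  inverse (name R) = R ⁻
  inverse (R ⁻)    = name R

  isTop? : (C : Concept S) → IsTop C ⊎ ¬ IsTop C
  isTop? (atom A)     = inj₂ λ ()
  isTop? (∃[ P ]∙ C) = inj₂ λ ()
  isTop? (C ⊓ D) with isTop? C | isTop? D
  ... | inj₁ C-top | inj₁ D-top = inj₁ (C-top ⊓ D-top)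
  ... | inj₂ C-not | _          = inj₂ λ { (C-top ⊓ _) → C-not C-top }
  ... | inj₁ _     | inj₂ D-not = inj₂ λ { (_ ⊓ D-top) → D-not D-top }
  isTop? top = inj₁ top

-- From classical to annotated models

module Inflation (𝕂 : CommutativeSemiring c ℓ) {S : Signature}
                 (I : Interpretation S (c ⊔ ℓ)) where
  open CommutativeSemiring 𝕂
  private module I where
    open Interpretation I public
    open Classical I public

  inflated : AnnInterpretation 𝕂 S
  inflated = record
    { Δ        = I.Δ
    ; nonempty = I.nonempty
    ; indⁱ     = I.indⁱ
    ; conⁱ     = λ A x _ → I.conⁱ A x
    ; rolⁱ     = λ R x y _ → I.rolⁱ R x y
    ; con-resp = λ _ → id
    ; rol-resp = λ _ → id
    }

  open Annotated 𝕂 inflated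

  role⁺ : ∀ P {x y} κ → I.roleⁱ P x y → roleⁱ P x y κ
  role⁺ (name R) _ = id
  role⁺ (R ⁻)    _ = id

  role⁻ : ∀ P {x y} κ → roleⁱ P x y κ → I.roleⁱ P x y
  role⁻ (name R) _ = id
  role⁻ (R ⁻)    _ = id

  concept⁻ : ∀ C {x} κ → conceptⁱ C x κ → I.conceptⁱ C x
  concept⁻ (atom A)     _ Ax = Ax
  concept⁻ (∃[ P ]∙ C) _ (_ , _ , (y , Pxy , Cy) , _) =
    y , role⁻ P _ Pxy , concept⁻ C _ Cy
  concept⁻ (C ⊓ D)      _ (_ , _ , Cx , Dx , _) = concept⁻ C _ Cx , concept⁻ D _ Dx
  concept⁻ top          _ _ = tt

  basic⁺ : ∀ B {x} κ → I.conceptⁱ ⌜ B ⌝ x → conceptⁱ ⌜ B ⌝ x κ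
  basic⁺ (atom A) κ Ax = Ax
  basic⁺ (some P) κ (y , Pxy , _) =
    -- `top` carries only `1#`, so the edge takes the whole annotation.
    κ , 1# , (y , role⁺ P κ Pxy , lift refl) , sym (*-identityʳ κ)

  inflated-model : (O : AnnotatedOntology 𝕂 S) →
                   I.IsModel (AnnotatedOntology.ontology O) → IsModel O
  inflated-model O model {assertion (concept A a)} α∈O = model α∈O
  inflated-model O model {assertion (role R a b)}  α∈O = model α∈O
  inflated-model O model {C ⊑ basic B}  α∈O x κ Cx =
    basic⁺ B _ (model α∈O x (concept⁻ C _ Cx))
  inflated-model O model {C ⊑ bot}      α∈O x κ Cx = model α∈O x (concept⁻ C _ Cx)
  inflated-model O model {ri (P ⊑ʳ Q)}  α∈O x y κ Pxy =
    role⁺ Q _ (model α∈O x y (role⁻ P _ Pxy))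
  inflated-model O model {ri (P ⊓ Q ⊑⊥)} α∈O x y κ (_ , _ , Pxy , Qxy , _) =
    model α∈O x y (role⁻ P _ Pxy , role⁻ Q _ Qxy)

  query⁻ : ∀ α {κ} → satQuery α κ → I.satQuery α
  query⁻ (assertion (concept A a)) sat = sat
  query⁻ (assertion (role R a b))  sat = sat
  query⁻ (bcq q) (π , _ , sat , _) = π , λ o → atom⁻ (lookup (BCQ.body q) o) (sat o)
    where
    -- The two evaluations are separate functions defined by cases on the term, so they agree only
    -- after a case split.
    term⁻ : ∀ {n} (π : Fin n → I.Δ) t → termⁱ π t ≡ I.termⁱ π t
    term⁻ π (ind a) = ≡.refl
    term⁻ π (var v) = ≡.refl

    atom⁻ : ∀ {n κ} {π : Fin n → I.Δ} E → satAtom π E κ → I.satAtom π E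
    atom⁻ {π = π} (concept A t) sat rewrite term⁻ π t = sat
    atom⁻ {π = π} (role R t u)  sat rewrite term⁻ π t | term⁻ π u = sat
  -- Premises carry every annotation, so `1#` is an arbitrary choice, here and in the next two
  -- cases.
  query⁻ (ri (P ⊑ʳ Q)) sat x y Pxy = role⁻ Q _ (sat x y 1# (role⁺ P _ Pxy))
  query⁻ (ri (P ⊓ Q ⊑⊥)) sat x y (Pxy , Qxy) =
    sat x y (1# * 1#) (1# , 1# , role⁺ P _ Pxy , role⁺ Q _ Qxy , refl)
  query⁻ (B ⊑ᵇ B′) sat x Bx = concept⁻ ⌜ B′ ⌝ _ (sat x 1# (basic⁺ B 1# Bx))

annotatedEntails⇒entails :
  (𝕂 : CommutativeSemiring c ℓ) {S : Signature} (O : AnnotatedOntology 𝕂 S)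
  (α : Query S) {κ : CommutativeSemiring.Carrier 𝕂} →
  AnnEntails 𝕂 O α κ → Entails (c ⊔ ℓ) (AnnotatedOntology.ontology O) α
annotatedEntails⇒entails 𝕂 O α entails I model =
  query⁻ α (entails inflated (inflated-model O model))
  where open Inflation 𝕂 I

-- From annotated to classical models

-- The two instances are the set of all elements and the set of nonzero ones.
record IsFace (𝕂 : CommutativeSemiring c ℓ)
              (N : CommutativeSemiring.Carrier 𝕂 → Set ℓ) : Set (c ⊔ ℓ) where
  open CommutativeSemiring 𝕂 hiding (zero)
  field
    resp : ∀ {a b} → a ≈ b → N a → N b
    one  : N 1#
    mul  : ∀ {a b} → N a → N b → N (a * b)
    fac  : ∀ {a b} → N (a * b) → N a × N b

  product : ∀ {n} (κs : Fin n → Carrier) → (∀ o → N (κs o)) → N (finiteProduct 𝕂 κs)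
  product {ℕ.zero}  κs Nκs = one
  product {ℕ.suc n} κs Nκs = mul (Nκs zero) (product (κs ∘ suc) (Nκs ∘ suc))

full-face : (𝕂 : CommutativeSemiring c ℓ) → IsFace 𝕂 (λ _ → ⊤)
-- Every field ends in the unit type, so eta fills the record.
full-face 𝕂 = _

nonzero-face : (𝕂 : CommutativeSemiring c ℓ) →
               let open CommutativeSemiring 𝕂 in
               IsPositive 𝕂 → ¬ (0# ≈ 1#) → IsFace 𝕂 (λ a → ¬ (a ≈ 0#))
nonzero-face 𝕂 pos 0≉1 = record
  { resp = λ a≈b a≉0 b≈0 → a≉0 (trans a≈b b≈0)
  ; one  = 0≉1 ∘ sym
  ; mul  = λ a≉0 b≉0 → [ a≉0 , b≉0 ]′ ∘ Equivalence.to (*-zero⇔ _ _)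
  ; fac  = λ ab≉0 → ab≉0 ∘ Equivalence.from (*-zero⇔ _ _) ∘ inj₁
                  , ab≉0 ∘ Equivalence.from (*-zero⇔ _ _) ∘ inj₂
  }
  where
  open CommutativeSemiring 𝕂
  open IsPositive pos

module Support {𝕂 : CommutativeSemiring c ℓ} {S : Signature}
               {N : CommutativeSemiring.Carrier 𝕂 → Set ℓ} (face : IsFace 𝕂 N)
               (M : AnnInterpretation 𝕂 S) where
  open CommutativeSemiring 𝕂
  open IsFace face
  open AnnInterpretation M
  open Annotated 𝕂 M

  support : Interpretation S (c ⊔ ℓ)
  support = record
    { Δ        = Δ
    ; nonempty = nonempty
    ; indⁱ     = indⁱ
    ; conⁱ     = λ A x → ∃[ κ ] N κ × conⁱ A x κ
    ; rolⁱ     = λ R x y → ∃[ κ ] N κ × rolⁱ R x y κ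
    }

  private module I = Classical support

  role⁺ : ∀ P {x y κ} → N κ → roleⁱ P x y κ → I.roleⁱ P x y
  role⁺ (name R) Nκ Pxy = _ , Nκ , Pxy
  role⁺ (R ⁻)    Nκ Pxy = _ , Nκ , Pxy

  role⁻ : ∀ P {x y} → I.roleⁱ P x y → ∃[ κ ] N κ × roleⁱ P x y κ
  role⁻ (name R) = id
  role⁻ (R ⁻)    = id

  concept⁻ : ∀ C {x} → I.conceptⁱ C x → ∃[ κ ] N κ × conceptⁱ C x κ
  concept⁻ (atom A) = id
  concept⁻ (∃[ P ]∙ C) (y , Pxy , Cy) with role⁻ P Pxy | concept⁻ C Cy
  ... | κ₁ , N₁ , Pxy | κ₂ , N₂ , Cy =
    κ₁ * κ₂ , mul N₁ N₂ , κ₁ , κ₂ , (y , Pxy , Cy) , refl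
  concept⁻ (C ⊓ D) (Cx , Dx) with concept⁻ C Cx | concept⁻ D Dx
  ... | κ₁ , N₁ , Cx | κ₂ , N₂ , Dx =
    κ₁ * κ₂ , mul N₁ N₂ , κ₁ , κ₂ , Cx , Dx , refl
  concept⁻ top _ = 1# , one , lift refl

  basic⁺ : ∀ B {x κ} → N κ → conceptⁱ ⌜ B ⌝ x κ → I.conceptⁱ ⌜ B ⌝ x
  basic⁺ (atom A) Nκ Ax = _ , Nκ , Ax
  basic⁺ (some P) Nκ (κ₁ , κ₂ , (y , Pxy , _) , κ≈) =
    -- The annotation is a product of those of the edge and of ⊤; `fac` passes membership in `N` to
    -- the edge factor.
    y , role⁺ P (proj₁ (fac (resp κ≈ Nκ))) Pxy , tt

  support-model : (O : AnnotatedOntology 𝕂 S) →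
                  let open AnnotatedOntology O in
                  (∀ {α} → α ∈ ontology → N (annot α)) →
                  IsModel O → I.IsModel ontology
  support-model O N-annot model {assertion (concept A a)} α∈O = _ , N-annot α∈O , model α∈O
  support-model O N-annot model {assertion (role R a b)}  α∈O = _ , N-annot α∈O , model α∈O
  support-model O N-annot model {C ⊑ basic B} α∈O x Cx with concept⁻ C Cx
  ... | κ , Nκ , Cx = basic⁺ B (mul (N-annot α∈O) Nκ) (model α∈O x κ Cx)
  support-model O N-annot model {C ⊑ bot} α∈O x Cx with concept⁻ C Cx
  ... | κ , Nκ , Cx = model α∈O x κ Cx
  support-model O N-annot model {ri (P ⊑ʳ Q)} α∈O x y Pxy with role⁻ P Pxy
  ... | κ , Nκ , Pxy = role⁺ Q (mul (N-annot α∈O) Nκ) (model α∈O x y κ Pxy)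
  support-model O N-annot model {ri (P ⊓ Q ⊑⊥)} α∈O x y (Pxy , Qxy)
    with role⁻ P Pxy | role⁻ Q Qxy
  ... | κ₁ , _ , Pxy | κ₂ , _ , Qxy =
    model α∈O x y (κ₁ * κ₂) (κ₁ , κ₂ , Pxy , Qxy , refl)

  assertion⁻ : ∀ α → I.satAssertion α → ∃[ κ ] N κ × satAssertion α κ
  assertion⁻ (concept A a) = id
  assertion⁻ (role R a b)  = id

  bcq⁻ : ∀ q → I.satBCQ q → ∃[ κ ] N κ × satBCQ q κ
  bcq⁻ q (π , sat) =
    finiteProduct 𝕂 κs , product κs Nκs , π , κs , sat′ , refl
    where
    term⁻ : ∀ {n} (π : Fin n → Δ) t → I.termⁱ π t ≡ termⁱ π t
    term⁻ π (ind a) = ≡.refl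
    term⁻ π (var v) = ≡.refl

    atom⁻ : ∀ {n} {π : Fin n → Δ} E → I.satAtom π E → ∃[ κ ] N κ × satAtom π E κ
    atom⁻ {π = π} (concept A t) sat rewrite term⁻ π t = sat
    atom⁻ {π = π} (role R t u)  sat rewrite term⁻ π t | term⁻ π u = sat

    annotated : ∀ o → ∃[ κ ] N κ × satAtom π (lookup (BCQ.body q) o) κ
    annotated o = atom⁻ (lookup (BCQ.body q) o) (sat o)

    κs : Fin (length (BCQ.body q)) → Carrier
    κs o = proj₁ (annotated o)

    Nκs : ∀ o → N (κs o)
    Nκs o = proj₁ (proj₂ (annotated o))

    sat′ : ∀ o → satAtom π (lookup (BCQ.body q) o) (κs o)
    sat′ o = proj₂ (proj₂ (annotated o))

-- Annotated interpretations up to semiring equality.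

module _ {𝕂 : CommutativeSemiring c ℓ} {S : Signature} (M : AnnInterpretation 𝕂 S) where
  open CommutativeSemiring 𝕂
  open AnnInterpretation M
  open Annotated 𝕂 M

  role-resp : ∀ P {x y κ κ′} → κ ≈ κ′ → roleⁱ P x y κ → roleⁱ P x y κ′
  role-resp (name R) = rol-resp
  role-resp (R ⁻)    = rol-resp

  concept-resp : ∀ C {x κ κ′} → κ ≈ κ′ → conceptⁱ C x κ → conceptⁱ C x κ′
  concept-resp (atom A) κ≈κ′ = con-resp κ≈κ′
  concept-resp (∃[ P ]∙ C) κ≈κ′ (κ₁ , κ₂ , sat , κ≈) =
    κ₁ , κ₂ , sat , trans (sym κ≈κ′) κ≈
  concept-resp (C ⊓ D) κ≈κ′ (κ₁ , κ₂ , Cx , Dx , κ≈) =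
    κ₁ , κ₂ , Cx , Dx , trans (sym κ≈κ′) κ≈
  concept-resp top κ≈κ′ (lift κ≈1) = lift (trans (sym κ≈κ′) κ≈1)

  role-inverse : ∀ P {x y κ} → roleⁱ P x y κ → roleⁱ (inverse P) y x κ
  role-inverse (name R) = id
  role-inverse (R ⁻)    = id

  -- As ⊤ is annotated by `1#` only, the annotations of ∃P at a point are exactly those of its
  -- outgoing P-edges; `some⁻` is the converse.
  some⁺ : ∀ P {x y κ} → roleⁱ P x y κ → conceptⁱ ⌜ some P ⌝ x κ
  some⁺ P {y = y} Pxy = _ , 1# , (y , Pxy , lift refl) , sym (*-identityʳ _)

  some⁻ : ∀ P {x κ} → conceptⁱ ⌜ some P ⌝ x κ → ∃[ y ] roleⁱ P x y κ
  some⁻ P (κ₁ , κ₂ , (y , Pxy , lift κ₂≈1) , κ≈) =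
    y , role-resp P (sym (trans κ≈ (trans (*-congˡ κ₂≈1) (*-identityʳ κ₁)))) Pxy

-- The chase

module Chase {𝕂 : CommutativeSemiring c ℓ} {S : Signature}
             (O : AnnotatedOntology 𝕂 S) (seed : Maybe (Basic S)) where
  open CommutativeSemiring 𝕂
  open Signature S
  open AnnotatedOntology O

  -- null P x κ n is the P-successor that the fact "x has a P-successor, with
  -- scalar κ and n seed uses" creates; it exists even if this fact is not
  -- derivable. Seed atom A is read as A(root), seed some P as P(root, leaf).
  data Node : Set (c ⊔ ℓ) where
    ind       : NI → Node
    root leaf : Node
    null      : Role S → Node → Carrier → ℕ → Node

  mutual
    -- Edges range over all roles and labels over all concepts, so that every axiom fires by a
    -- single constructor. Counts add where scalars multiply, since they are exponents of the seed
    -- annotation. `resp` gives the closure under `≈` that an annotated interpretation must have.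
    data Edge : Role S → Node → Node → Carrier → ℕ → Set (c ⊔ ℓ) where
      seeded   : ∀ {P} → seed ≡ just (some P) → Edge P root leaf 1# 1
      asserted : ∀ {R a b} → assertion (role R a b) ∈ ontology →
                 Edge (name R) (ind a) (ind b) (annot (assertion (role R a b))) 0
      created  : ∀ {C P x κ n} → (C ⊑ basic (some P)) ∈ ontology → Label C x κ n →
                 let κ′ = annot (C ⊑ basic (some P)) * κ in
                 Edge P x (null P x κ′ n) κ′ n
      included : ∀ {P Q x y κ n} → ri (P ⊑ʳ Q) ∈ ontology → Edge P x y κ n →
                 Edge Q x y (annot (ri (P ⊑ʳ Q)) * κ) n
      inverted : ∀ {P x y κ n} → Edge P x y κ n → Edge (inverse P) y x κ n
      resp     : ∀ {P x y κ κ′ n} → κ ≈ κ′ → Edge P x y κ n → Edge P x y κ′ n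

    data Label : Concept S → Node → Carrier → ℕ → Set (c ⊔ ℓ) where
      seeded   : ∀ {A} → seed ≡ just (atom A) → Label (atom A) root 1# 1
      asserted : ∀ {A a} → assertion (concept A a) ∈ ontology →
                 Label (atom A) (ind a) (annot (assertion (concept A a))) 0
      included : ∀ {C A x κ n} → (C ⊑ basic (atom A)) ∈ ontology → Label C x κ n →
                 Label (atom A) x (annot (C ⊑ basic (atom A)) * κ) n
      step     : ∀ {P C x y κ₁ κ₂ m n} → Edge P x y κ₁ m → Label C y κ₂ n →
                 Label (∃[ P ]∙ C) x (κ₁ * κ₂) (m ℕ.+ n)
      _⊓_      : ∀ {C D x κ₁ κ₂ m n} → Label C x κ₁ m → Label D x κ₂ n →
                 Label (C ⊓ D) x (κ₁ * κ₂) (m ℕ.+ n)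
      top      : ∀ {x} → Label top x 1# 0
      resp     : ∀ {C x κ κ′ n} → κ ≈ κ′ → Label C x κ n → Label C x κ′ n

  chase : AnnInterpretation 𝕂 S
  chase = record
    { Δ        = Node
    ; nonempty = root
    ; indⁱ     = ind
    ; conⁱ     = λ A x κ → ∃[ n ] Label (atom A) x κ n
    ; rolⁱ     = λ R x y κ → ∃[ n ] Edge (name R) x y κ n
    ; con-resp = λ κ≈κ′ (n , Ax) → n , resp κ≈κ′ Ax
    ; rol-resp = λ κ≈κ′ (n , Rxy) → n , resp κ≈κ′ Rxy
    }

  private module Ch = Annotated 𝕂 chase

  role⁺ : ∀ P {x y κ n} → Edge P x y κ n → Ch.roleⁱ P x y κ
  role⁺ (name R) Pxy = _ , Pxy
  role⁺ (R ⁻)    Pxy = _ , inverted Pxy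

  role⁻ : ∀ P {x y κ} → Ch.roleⁱ P x y κ → ∃[ n ] Edge P x y κ n
  role⁻ (name R) Pxy       = Pxy
  role⁻ (R ⁻)    (n , Ryx) = n , inverted Ryx

  concept⁻ : ∀ C {x κ} → Ch.conceptⁱ C x κ → ∃[ n ] Label C x κ n
  concept⁻ (atom A) Ax = Ax
  concept⁻ (∃[ P ]∙ C) (_ , _ , (y , Pxy , Cy) , κ≈) with role⁻ P Pxy | concept⁻ C Cy
  ... | m , Pxy | n , Cy = m ℕ.+ n , resp (sym κ≈) (step Pxy Cy)
  concept⁻ (C ⊓ D) (_ , _ , Cx , Dx , κ≈) with concept⁻ C Cx | concept⁻ D Dx
  ... | m , Cx | n , Dx = m ℕ.+ n , resp (sym κ≈) (Cx ⊓ Dx)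
  concept⁻ top (lift κ≈1) = 0 , resp (sym κ≈1) top

  -- These are the nodes that grow out of the seed, as opposed to those that grow out of an
  -- individual.
  Anonymous : Node → Set
  Anonymous (ind _)        = Empty.⊥
  Anonymous root           = Unit.⊤
  Anonymous leaf           = Unit.⊤
  Anonymous (null _ x _ _) = Anonymous x

  Seedpoint : Node → Set
  Seedpoint root = Unit.⊤
  Seedpoint leaf = Unit.⊤
  Seedpoint _    = Empty.⊥

  -- Asserted edges join individuals and created ones touch a null. So an edge between seed points
  -- comes from the seed edge by inclusions and inversions, which keep the count.
  seedpoints-linear : ∀ {P x y κ n} → Edge P x y κ n → Seedpoint x → Seedpoint y → n ≡ 1
  seedpoints-linear (seeded _)      _  _  = ≡.refl
  seedpoints-linear (included _ e)  sx sy = seedpoints-linear e sx sy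
  seedpoints-linear (inverted e)    sx sy = seedpoints-linear e sy sx
  seedpoints-linear (resp _ e)      sx sy = seedpoints-linear e sx sy

  -- A null inherits its status from its parent, and the seed edge and the assertions stay on one
  -- side each. Hence no edge connects the two parts of the chase.
  anonymous-closed : ∀ {P x y κ n} → Edge P x y κ n →
                     (Anonymous x → Anonymous y) × (Anonymous y → Anonymous x)
  anonymous-closed (seeded _)     = id , id
  anonymous-closed (asserted _)   = id , id
  anonymous-closed (created _ _)  = id , id
  anonymous-closed (included _ e) = anonymous-closed e
  anonymous-closed (inverted e)   = let f , g = anonymous-closed e in g , f
  anonymous-closed (resp _ e)     = anonymous-closed e

  module _ (noTop : NoTopGCI ontology) where
    mutual
      edge-uses-seed : ∀ {P x y κ n} → Edge P x y κ n → Anonymous x → 1 ≤ n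
      edge-uses-seed (seeded _)      _ = s≤s z≤n
      edge-uses-seed (created ax Cx) a =
        [ (λ C-top → contradiction C-top (noTop ax)) , id ]′ (label-uses-seed Cx a)
      edge-uses-seed (included _ e)  a = edge-uses-seed e a
      edge-uses-seed (inverted e)    a = edge-uses-seed e (proj₂ (anonymous-closed e) a)
      edge-uses-seed (resp _ e)      a = edge-uses-seed e a

      -- No assertion reaches an anonymous node, so the only other source of labels there is ⊤.
      -- Conjunctions of ⊤ lead no further, because no GCI has such a left-hand side.
      label-uses-seed : ∀ {C x κ n} → Label C x κ n → Anonymous x → IsTop C ⊎ 1 ≤ n
      label-uses-seed (seeded _)      _ = inj₂ (s≤s z≤n)
      label-uses-seed (included ax Cx) a =
        [ (λ C-top → contradiction C-top (noTop ax)) , inj₂ ]′ (label-uses-seed Cx a)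
      -- The edge alone provides a use of the seed; the filler may be ⊤.
      label-uses-seed (step e _)      a = inj₂ (≤-trans (edge-uses-seed e a) (m≤m+n _ _))
      label-uses-seed (Cx ⊓ Dx)       a with label-uses-seed Cx a | label-uses-seed Dx a
      ... | inj₁ C-top | inj₁ D-top = inj₁ (C-top ⊓ D-top)
      ... | inj₂ 1≤m   | _          = inj₂ (≤-trans 1≤m (m≤m+n _ _))
      ... | inj₁ _     | inj₂ 1≤n   = inj₂ (≤-trans 1≤n (m≤n+m _ _))
      label-uses-seed top             _ = inj₁ top
      label-uses-seed (resp _ Cx)     a = label-uses-seed Cx a

    basic-uses-seed : ∀ B {x κ n} → Label ⌜ B ⌝ x κ n → Anonymous x → 1 ≤ n
    basic-uses-seed (atom A) Bx a with label-uses-seed Bx a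
    ... | inj₂ 1≤n = 1≤n
    basic-uses-seed (some P) Bx a with label-uses-seed Bx a
    ... | inj₂ 1≤n = 1≤n

  -- The chase rules ignore axioms with ⊥ on the right. That these hold is a separate condition,
  -- obtained later by mapping the chase into some model.
  Consistent : Set (c ⊔ ℓ)
  Consistent =
    (∀ {C x κ n} → (C ⊑ bot) ∈ ontology → ¬ Label C x κ n) ×
    (∀ {P Q x y κ₁ κ₂ m n} → ri (P ⊓ Q ⊑⊥) ∈ ontology →
     Edge P x y κ₁ m → ¬ Edge Q x y κ₂ n)

  chase-model : Consistent → Ch.IsModel O
  chase-model _ {assertion (concept A a)} α∈O = 0 , asserted α∈O
  chase-model _ {assertion (role R a b)}  α∈O = 0 , asserted α∈O
  chase-model _ {C ⊑ basic (atom A)} α∈O x κ Cx with concept⁻ C Cx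
  ... | n , Cx = n , included α∈O Cx
  chase-model _ {C ⊑ basic (some P)} α∈O x κ Cx with concept⁻ C Cx
  ... | n , Cx = some⁺ chase P (role⁺ P (created α∈O Cx))
  chase-model (con , _) {C ⊑ bot} α∈O x κ Cx =
    contradiction (proj₂ (concept⁻ C Cx)) (con α∈O)
  chase-model _ {ri (P ⊑ʳ Q)} α∈O x y κ Pxy with role⁻ P Pxy
  ... | n , Pxy = role⁺ Q (included α∈O Pxy)
  chase-model (_ , con) {ri (P ⊓ Q ⊑⊥)} α∈O x y κ (_ , _ , Pxy , Qxy , _) =
    con α∈O (proj₂ (role⁻ P Pxy)) (proj₂ (role⁻ Q Qxy))

  -- `u` and `v` are the images of `root` and `leaf`. Only the form of the seed constrains them: `v`
  -- is arbitrary unless the seed is some P, and without a seed `u` and `z` are arbitrary too.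
  record SeededModel (M : AnnInterpretation 𝕂 S) : Set (c ⊔ ℓ) where
    open AnnInterpretation M
    open Annotated 𝕂 M
    field
      model          : IsModel O
      u v            : Δ
      z              : Carrier
      seeded-concept : ∀ {A} → seed ≡ just (atom A) → conⁱ A u z
      seeded-role    : ∀ {P} → seed ≡ just (some P) → roleⁱ P u v z

  module Homomorphism (em : ExcludedMiddle (c ⊔ ℓ)) {M : AnnInterpretation 𝕂 S}
                      (seededModel : SeededModel M) where
    open AnnInterpretation M
    open Annotated 𝕂 M
    open SeededModel seededModel
    open Exp semiring using (_^_; ^-homo-*)
    open CommutativeSemigroupProperties *-commutativeSemigroup using (interchange)

    -- The name of a null tells which successor its image has to be. Such a successor may be missing
    -- when the creating fact is not derivable; excluded middle decides, with `u` as default. This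
    -- makes `hom` a recursion on nodes that does not depend on derivations.
    hom : Node → Δ
    hom (ind a) = indⁱ a
    hom root    = u
    hom leaf    = v
    hom (null P x κ n) with em {∃[ y ] roleⁱ P (hom x) y (κ * z ^ n)}
    ... | yes (y , _) = y
    ... | no _        = u

    hom-null : ∀ P x κ n → (∃[ y ] roleⁱ P (hom x) y (κ * z ^ n)) →
               roleⁱ P (hom x) (hom (null P x κ n)) (κ * z ^ n)
    hom-null P x κ n successor with em {∃[ y ] roleⁱ P (hom x) y (κ * z ^ n)}
    ... | yes (_ , Pxy) = Pxy
    ... | no none       = contradiction successor none

    scalar-seed : z ≈ 1# * z ^ 1
    scalar-seed = sym (trans (*-identityˡ _) (*-identityʳ z))

    scalar-split : ∀ κ₁ κ₂ m n → (κ₁ * κ₂) * z ^ (m ℕ.+ n) ≈ (κ₁ * z ^ m) * (κ₂ * z ^ n)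
    scalar-split κ₁ κ₂ m n =
      trans (*-congˡ (^-homo-* z m n)) (interchange κ₁ κ₂ (z ^ m) (z ^ n))

    mutual
      hom-edge : ∀ {P x y κ n} → Edge P x y κ n → roleⁱ P (hom x) (hom y) (κ * z ^ n)
      hom-edge {P} (seeded seed≡) = role-resp M P scalar-seed (seeded-role seed≡)
      hom-edge (asserted α∈O) = rol-resp (sym (*-identityʳ _)) (model α∈O)
      -- The GCI holds in `M`, so the image of `x` has a successor with the annotation that `hom`
      -- looks for, once the product is reassociated.
      hom-edge (created {P = P} α∈O Cx) =
        hom-null P _ _ _
          (some⁻ M P (concept-resp M ⌜ some P ⌝ (sym (*-assoc _ _ _))
            (model α∈O _ _ (hom-label Cx))))
      hom-edge {P} (included α∈O e) =
        role-resp M P (sym (*-assoc _ _ _)) (model α∈O _ _ _ (hom-edge e))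
      hom-edge (inverted {P} e) = role-inverse M P (hom-edge e)
      hom-edge {P} (resp κ≈κ′ e) = role-resp M P (*-congʳ κ≈κ′) (hom-edge e)

      hom-label : ∀ {C x κ n} → Label C x κ n → conceptⁱ C (hom x) (κ * z ^ n)
      hom-label (seeded seed≡) = con-resp scalar-seed (seeded-concept seed≡)
      hom-label (asserted α∈O) = con-resp (sym (*-identityʳ _)) (model α∈O)
      hom-label (included α∈O Cx) =
        con-resp (sym (*-assoc _ _ _)) (model α∈O _ _ (hom-label Cx))
      hom-label (step {κ₁ = κ₁} {κ₂} {m} {n} e Cy) =
        _ , _ , (_ , hom-edge e , hom-label Cy) , scalar-split κ₁ κ₂ m n
      hom-label (_⊓_ {κ₁ = κ₁} {κ₂} {m} {n} Cx Dx) =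
        _ , _ , hom-label Cx , hom-label Dx , scalar-split κ₁ κ₂ m n
      hom-label top = lift (*-identityʳ 1#)
      hom-label {C} (resp κ≈κ′ Cx) = concept-resp M C (*-congʳ κ≈κ′) (hom-label Cx)

    -- A violated negative axiom would be carried to a violation in `M`, which tolerates none,
    -- whatever the annotations.
    consistent : Consistent
    consistent =
      (λ α∈O Cx → lower (model α∈O _ _ (hom-label Cx))) ,
      (λ α∈O e e′ → model α∈O _ _ _ (_ , _ , hom-edge e , hom-edge e′ , refl))

-- Uniform nonzero annotations of entailed queries

NonzeroEntailed : {𝕂 : CommutativeSemiring c ℓ} {S : Signature} →
                  AnnotatedOntology 𝕂 S → Query S → Set (Level.suc (c ⊔ ℓ))
NonzeroEntailed {𝕂 = 𝕂} O α = ∃[ κ ] ¬ (κ ≈ 0#) × AnnEntails 𝕂 O α κ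
  where open CommutativeSemiring 𝕂

module _ (em : ∀ {p} → ExcludedMiddle p)
         {S : Signature} {𝕂 : CommutativeSemiring c ℓ}
         (0≉1 : ¬ CommutativeSemiring._≈_ 𝕂 (CommutativeSemiring.0# 𝕂)
                                            (CommutativeSemiring.1# 𝕂))
         (pos : IsPositive 𝕂) (O : AnnotatedOntology 𝕂 S) where
  open CommutativeSemiring 𝕂
  open AnnotatedOntology O
  open Exp semiring using (_^_)

  private
    nonzeros = nonzero-face 𝕂 pos 0≉1

  module UnseededChase where
    open Chase O nothing

    module _ (M : AnnInterpretation 𝕂 S) (model : Annotated.IsModel 𝕂 M O) where
      open AnnInterpretation M
      open Annotated 𝕂 M
      private module Ch = Annotated 𝕂 chase

      seededModel : SeededModel M
      seededModel = record
        { model          = model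
        -- There is no seed to interpret, and `z` is `1#` so that the factor zⁿ disappears.
        ; u              = nonempty
        ; v              = nonempty
        ; z              = 1#
        ; seeded-concept = λ ()
        ; seeded-role    = λ ()
        }

      open Homomorphism em seededModel public

      unscale : ∀ κ n → κ * 1# ^ n ≈ κ
      unscale κ n = trans (*-congˡ (one^ n)) (*-identityʳ κ)
        where
        one^ : ∀ n → 1# ^ n ≈ 1#
        one^ ℕ.zero    = refl
        -- Powers are multiples in the multiplicative monoid, where `1#` is idempotent.
        one^ (ℕ.suc n) = Mult.×-idem *-monoid (*-identityˡ 1#) (ℕ.suc n)

      atom-hom : ∀ {A x κ} → Ch.conceptⁱ (atom A) x κ → conⁱ A (hom x) κ
      atom-hom (n , Ax) = con-resp (unscale _ n) (hom-label Ax)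

      name-hom : ∀ {R x y κ} → Ch.roleⁱ (name R) x y κ → rolⁱ R (hom x) (hom y) κ
      name-hom (n , Rxy) = rol-resp (unscale _ n) (hom-edge Rxy)

      assertion-hom : ∀ α {κ} → Ch.satAssertion α κ → satAssertion α κ
      assertion-hom (concept A a) = atom-hom
      assertion-hom (role R a b)  = name-hom

      bcq-hom : ∀ q {κ} → Ch.satBCQ q κ → satBCQ q κ
      bcq-hom q (π , κs , sat , κ≈) =
        hom ∘ π , κs , (λ o → satAtom-hom (lookup (BCQ.body q) o) (sat o)) , κ≈
        where
        term-hom : ∀ t → hom (Ch.termⁱ π t) ≡ termⁱ (hom ∘ π) t
        term-hom (ind a) = ≡.refl
        term-hom (var v) = ≡.refl

        satAtom-hom : ∀ E {κ} → Ch.satAtom π E κ → satAtom (hom ∘ π) E κ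
        satAtom-hom (concept A t) sat rewrite ≡.sym (term-hom t) = atom-hom sat
        satAtom-hom (role R t u)  sat
          rewrite ≡.sym (term-hom t) | ≡.sym (term-hom u) = name-hom sat

  -- Without models every annotation is entailed vacuously. This case is separate because only a
  -- model shows that the chase is consistent.
  nonzero-unsatisfiable : (α : Query S) →
    ¬ (∃[ M ] Annotated.IsModel 𝕂 {S} M O) → NonzeroEntailed O α
  nonzero-unsatisfiable α none =
    1# , 0≉1 ∘ sym , λ M model → contradiction (M , λ {α} → model {α}) none

  nonzero-assertion : ∀ α → Entails (c ⊔ ℓ) ontology (assertion α) →
                      NonzeroEntailed O (assertion α)
  nonzero-assertion α entails with em {P = ∃[ M ] Annotated.IsModel 𝕂 {S} M O}
  ... | no none = nonzero-unsatisfiable (assertion α) none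
  ... | yes (M , model) =
    -- `M` serves for consistency alone. The annotation is read off the chase before `M′` is given,
    -- so it is the same for all models.
    let κ , κ≉0 , sat = assertion⁻ α (entails support (support-model O nonzero
                          (chase-model (UnseededChase.consistent M model))))
    in κ , κ≉0 , λ M′ model′ → UnseededChase.assertion-hom M′ model′ α sat
    where
    open Chase O nothing
    open Support nonzeros chase

  nonzero-bcq : ∀ q → Entails (c ⊔ ℓ) ontology (bcq q) → NonzeroEntailed O (bcq q)
  nonzero-bcq q entails with em {P = ∃[ M ] Annotated.IsModel 𝕂 {S} M O}
  ... | no none = nonzero-unsatisfiable (bcq q) none
  ... | yes (M , model) =
    let κ , κ≉0 , sat = bcq⁻ q (entails support (support-model O nonzero
                          (chase-model (UnseededChase.consistent M model))))
    in κ , κ≉0 , λ M′ model′ → UnseededChase.bcq-hom M′ model′ q sat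
    where
    open Chase O nothing
    open Support nonzeros chase

  nonzero-disjointness : ∀ P Q → Entails (c ⊔ ℓ) ontology (ri (P ⊓ Q ⊑⊥)) →
                         NonzeroEntailed O (ri (P ⊓ Q ⊑⊥))
  nonzero-disjointness P Q entails =
    1# , 0≉1 ∘ sym , unsatisfiable
    where
    unsatisfiable : AnnEntails 𝕂 O (ri (P ⊓ Q ⊑⊥)) 1#
    unsatisfiable M model x y _ (_ , _ , Pxy , Qxy , _) =
      entails support (support-model O _ model) x y (role⁺ P _ Pxy , role⁺ Q _ Qxy)
      where open Support (full-face 𝕂) M

  nonzero-roleInclusion : ∀ P Q → Entails (c ⊔ ℓ) ontology (ri (P ⊑ʳ Q)) →
                          NonzeroEntailed O (ri (P ⊑ʳ Q))
  nonzero-roleInclusion P Q entails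
    with em {P = ∃[ M ] Annotated.IsModel 𝕂 {S} M O ×
                        ∃[ x ] ∃[ y ] ∃[ z ] Annotated.roleⁱ 𝕂 M P x y z}
  -- P is empty in every model, so any nonzero annotation would do.
  ... | no none = 1# , 0≉1 ∘ sym , λ M model x y z Pxy →
    contradiction (M , (λ {α} → model {α}) , x , y , z , Pxy) none
  ... | yes (M , model , x , y , z , Pxy) = derived
    where
    open Chase O (just (some P))
    open Support nonzeros chase
      using (support; support-model) renaming (role⁺ to support⁺; role⁻ to support⁻)

    -- Any P-edge of any model can be the image of the seed edge, so one derivation in the chase
    -- serves all of them.
    seededModel : ∀ M → Annotated.IsModel 𝕂 M O →
                  ∀ {x y z} → Annotated.roleⁱ 𝕂 M P x y z → SeededModel M
    seededModel M model {x} {y} {z} Pxy = record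
      { model          = model
      ; u              = x
      ; v              = y
      ; z              = z
      ; seeded-concept = λ ()
      ; seeded-role    = λ { ≡.refl → Pxy }
      }

    derived : NonzeroEntailed O (ri (P ⊑ʳ Q))
    derived with support⁻ Q (entails support
                   (support-model O nonzero (chase-model (Homomorphism.consistent em (seededModel M model Pxy))))
                   root leaf (support⁺ P (0≉1 ∘ sym) (role⁺ P (seeded ≡.refl))))
    ... | κ , κ≉0 , sat with role⁻ Q sat
    ...   | n , e with seedpoints-linear e _ _
    -- With count 1 the image annotation is κ z¹, the value that the inclusion requires.
    ...     | ≡.refl = κ , κ≉0 , λ M model x y z Pxy →
      role-resp M Q (*-congˡ (*-identityʳ z)) (Homomorphism.hom-edge em (seededModel M model Pxy) e)

  nonzero-GCI : ⊗-Idempotent 𝕂 → NoTopGCI ontology →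
                ∀ B B′ → Entails (c ⊔ ℓ) ontology (B ⊑ᵇ B′) → NonzeroEntailed O (B ⊑ᵇ B′)
  nonzero-GCI idem noTop B B′ entails
    with em {P = ∃[ M ] Annotated.IsModel 𝕂 {S} M O ×
                        ∃[ x ] ∃[ z ] Annotated.conceptⁱ 𝕂 M ⌜ B ⌝ x z}
  ... | no none = 1# , 0≉1 ∘ sym , λ M model x z Bx →
    contradiction (M , (λ {α} → model {α}) , x , z , Bx) none
  ... | yes (M , model , x , z , Bx) = derived
    where
    open Chase O (just B)
    open Support nonzeros chase
      using (support; support-model; basic⁺) renaming (concept⁻ to support⁻)

    partner : ∀ M B {x z} → Annotated.conceptⁱ 𝕂 M ⌜ B ⌝ x z → AnnInterpretation.Δ M
    -- An atomic seed has no seed edge, so `leaf` may go anywhere.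
    partner M (atom A) {x} _  = x
    partner M (some P)     Bx = proj₁ (some⁻ M P Bx)

    seededModel : ∀ M → Annotated.IsModel 𝕂 M O →
                  ∀ {x z} → Annotated.conceptⁱ 𝕂 M ⌜ B ⌝ x z → SeededModel M
    seededModel M model {x} {z} Bx = record
      { model          = model
      ; u              = x
      ; v              = partner M B Bx
      ; z              = z
      ; seeded-concept = λ { ≡.refl → Bx }
      ; seeded-role    = λ { {P} ≡.refl → proj₂ (some⁻ M P Bx) }
      }

    -- The seed of the chase stays `B` while the case split is made on `B₀`.
    seeded-root : ∀ B₀ → just B ≡ just B₀ → Annotated.conceptⁱ 𝕂 chase ⌜ B₀ ⌝ root 1#
    seeded-root (atom A) seed≡ = 1 , seeded seed≡
    seeded-root (some P) seed≡ = some⁺ chase P (role⁺ P (seeded seed≡))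

    derived : NonzeroEntailed O (B ⊑ᵇ B′)
    derived with support⁻ ⌜ B′ ⌝ (entails support
                   (support-model O nonzero (chase-model (Homomorphism.consistent em (seededModel M model Bx))))
                   root (basic⁺ B (0≉1 ∘ sym) (seeded-root B ≡.refl)))
    ... | κ , κ≉0 , sat with concept⁻ ⌜ B′ ⌝ sat
    ...   | n , B′root = κ , κ≉0 , λ M model x z Bx →
      concept-resp M ⌜ B′ ⌝
        -- `root` is anonymous and `B′` is basic, so n is positive and idempotency reduces zⁿ to z.
        (*-congˡ (Mult.×-idem *-monoid (idem z) n
          {{ℕ.>-nonZero (basic-uses-seed noTop B′ B′root _)}}))
        (Homomorphism.hom-label em (seededModel M model Bx) B′root)

theorem5p1 : (∀ {p} → ExcludedMiddle p) →
    ∀ {c ℓ} (S : Signature) (𝕂 : CommutativeSemiring c ℓ) →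
    let open CommutativeSemiring 𝕂 in
    (sums : Summability 𝕂) →
    ¬ (0# ≈ 1#) →
    (O : AnnotatedOntology 𝕂 S) (α : Query S) →
    let open AnnotatedOntology O using (ontology) in
    (¬ Entails (c ⊔ ℓ) ontology α → Provenance 𝕂 sums α O ≈ 0#)
    × (IsPositive 𝕂 → IsAssertionOrBCQOrRI α →
    Provenance 𝕂 sums α O ≈ 0# → ¬ Entails (c ⊔ ℓ) ontology α)
    × (IsPositive 𝕂 → ⊗-Idempotent 𝕂 → NoTopGCI ontology →
    Provenance 𝕂 sums α O ≈ 0# → ¬ Entails (c ⊔ ℓ) ontology α)
theorem5p1 em {c} {ℓ} S 𝕂 sums 0≉1 O α =
  (λ not-entailed → sumOver-empty sums (AnnEntails 𝕂 O α) λ κ →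
    not-entailed ∘ annotatedEntails⇒entails 𝕂 O α {κ}) ,
  (λ pos shape P≈0 → conclude pos P≈0 (simple pos α shape)) ,
  (λ pos idem noTop P≈0 → conclude pos P≈0 (any pos idem noTop α))
  where
  open CommutativeSemiring 𝕂
  open AnnotatedOntology O using (ontology)

  conclude : IsPositive 𝕂 → Provenance 𝕂 sums α O ≈ 0# →
             (Entails (c ⊔ ℓ) ontology α → NonzeroEntailed O α) →
             ¬ Entails (c ⊔ ℓ) ontology α
  conclude pos P≈0 nonzero entails =
    let κ , κ≉0 , annEntails = nonzero entails
    in κ≉0 (sumOver-zero em pos sums (AnnEntails 𝕂 O α) P≈0 κ annEntails)

  simple : IsPositive 𝕂 → ∀ α → IsAssertionOrBCQOrRI α →
           Entails (c ⊔ ℓ) ontology α → NonzeroEntailed O α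
  simple pos (assertion α)     assertion = nonzero-assertion em 0≉1 pos O α
  simple pos (bcq q)           bcq       = nonzero-bcq em 0≉1 pos O q
  simple pos (ri (P ⊑ʳ Q))     ri        = nonzero-roleInclusion em 0≉1 pos O P Q
  simple pos (ri (P ⊓ Q ⊑⊥))   ri        = nonzero-disjointness em 0≉1 pos O P Q

  any : IsPositive 𝕂 → ⊗-Idempotent 𝕂 → NoTopGCI ontology → ∀ α →
        Entails (c ⊔ ℓ) ontology α → NonzeroEntailed O α
  any pos idem noTop α@(assertion _) = simple pos α assertion
  any pos idem noTop α@(bcq _)       = simple pos α bcq
  any pos idem noTop α@(ri _)        = simple pos α ri
  any pos idem noTop (B ⊑ᵇ B′)       = nonzero-GCI em 0≉1 pos O idem noTop B B′
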